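{- For every finite simple graph $G$ (with at least one edge), $\frac{\nu(G)}{\alpha_2(G)} \le \frac{5}{4}$.
   Context: Graphs are finite, undirected, without loops or multiple edges. $\nu(G)$ is the size of a maximum matching of $G$. Let $B_2(G)$ be the set of ordered pairs $(H,H')$ of edge-disjoint matchings of $G$, let $\lambda_2(G)=\max\{|H|+|H'| : (H,H')\in B_2(G)\}$, and let $\alpha_2(G)=\max\{|H|,|H'| : (H,H')\in B_2(G),\ |H|+|H'|=\lambda_2(G)\}$. -}

module Defs where

open import Data.Nat using (ℕ; _+_; _≤_; _⊔_)
open import Data.Fin using (Fin; _<_)
open import Data.Product using (Σ; ∃; ∃-syntax; _×_; _,_)
open import Data.List using (List; []; _∷_; length; concatMap)
open import Data.List.Relation.Unary.All using (All)
open import Data.List.Relation.Unary.Unique.Propositional using (Unique)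
open import Data.List.Membership.Propositional using (_∈_; _∉_)
open import Relation.Nullary using (¬_)
open import Relation.Binary.PropositionalEquality using (_≡_)

record Graph (n : ℕ) : Set₁ where
  field
    Adj    : Fin n → Fin n → Set
    sym    : ∀ {u v} → Adj u v → Adj v u
    irrefl : ∀ u → ¬ Adj u u
open Graph public

-- An edge {u,v} is represented canonically by the ordered pair (u , v) with u < v.
Edge : ℕ → Set
Edge n = Fin n × Fin n

IsEdge : ∀ {n} → Graph n → Edge n → Set
IsEdge G (u , v) = (u < v) × Adj G u v

endpoints : ∀ {n} → List (Edge n) → List (Fin n)
endpoints = concatMap (λ { (u , v) → u ∷ v ∷ [] })

-- A matching: a list of edges of G, no vertex covered twice
-- (this also forces the edges in the list to be distinct).
IsMatching : ∀ {n} → Graph n → List (Edge n) → Set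
IsMatching G M = All (IsEdge G) M × Unique (endpoints M)

InB2 : ∀ {n} → Graph n → List (Edge n) → List (Edge n) → Set
InB2 G H H' = IsMatching G H × IsMatching G H' × (∀ e → e ∈ H → e ∉ H')

IsNu : ∀ {n} → Graph n → ℕ → Set
IsNu G k =
  (∃[ M ] (IsMatching G M × length M ≡ k)) ×
  (∀ M → IsMatching G M → length M ≤ k)

IsLambda2 : ∀ {n} → Graph n → ℕ → Set
IsLambda2 G l =
  (∃[ H ] ∃[ H' ] (InB2 G H H' × length H + length H' ≡ l)) ×
  (∀ H H' → InB2 G H H' → length H + length H' ≤ l)

IsAlpha2 : ∀ {n} → Graph n → ℕ → Set
IsAlpha2 G a = Σ ℕ λ l → IsLambda2 G l ×
  (∃[ H ] ∃[ H' ] (InB2 G H H' × length H + length H' ≡ l × length H ⊔ length H' ≡ a)) ×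
  (∀ H H' → InB2 G H H' → length H + length H' ≡ l → length H ⊔ length H' ≤ a)

HasEdge : ∀ {n} → Graph n → Set
HasEdge G = ∃[ u ] ∃[ v ] Adj G u v

{-# OPTIONS --safe #-}
module Submission where

-- Let (P , Q) be an optimal pair, |P| being as large as possible, and M any matching. Replacing
-- edges of P or Q by edges of M as long as this adds to M ∩ (P ∪ Q), we may assume that an edge of M
-- with an end uncovered by P lies in Q, and vice versa. Let x be covered by M and not by P. Then
-- x is the end of a path of P ∪ Q starting with an edge of Q, and this path does not end
-- with an edge of Q as well, since switching P and Q along it would enlarge P. If the path has length
-- two, its other end is covered by P but not by M; such x are paid for by the covered vertices they
-- lead to. Otherwise the four vertices after x are covered by P, and these quadruples are disjoint
-- for different x, as two overlapping ones would give a switchable path with at most eight vertices.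
-- Hence 4 (|V(M)| − |V(P)|) ≤ |V(P)|.

open import Defs
  renaming (sym to Adj-sym)
open import Data.Nat using (ℕ; zero; suc; _+_; _*_; _≤_; z≤n; s≤s; _⊔_)
import Data.Nat.Properties as ℕ
open import Data.Bool using (true; false; if_then_else_)
open import Data.Fin using (Fin; _<_)
import Data.Fin.Properties as Fin
open import Data.Product using (∃; ∃-syntax; _×_; _,_; proj₁; proj₂)
open import Data.Sum as Sum using (_⊎_; inj₁; inj₂)
open import Data.List using (List; []; _∷_; _++_; length; map; filter; concat; allFin)
open import Data.Nat.ListAction using (sum)
open import Data.List.Properties using (length-++; length-map; length-filter; length-tabulate; map-cong)
open import Data.List.Membership.Propositional using (_∈_; _∉_)
open import Data.List.Membership.Propositional.Properties
  using (∈-∃++; ∈-++⁺ˡ; ∈-++⁺ʳ; ∈-++⁻; ∈-map⁺; ∈-map⁻; ∈-filter⁺; ∈-filter⁻; ∈-allFin)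
open import Data.List.Relation.Binary.Disjoint.Propositional using (Disjoint)
open import Data.List.Relation.Unary.All as All using (All; []; _∷_)
import Data.List.Relation.Unary.All.Properties as All
open import Data.List.Relation.Unary.AllPairs using ([]; _∷_)
open import Data.List.Relation.Unary.Any using (here; there)
open import Data.List.Relation.Unary.Unique.Propositional using (Unique)
import Data.List.Relation.Unary.Unique.Propositional.Properties as Unique
open import Algebra.Properties.CommutativeSemigroup ℕ.+-commutativeSemigroup using (interchange)
open import Level using (0ℓ)
open import Function using (_∘_; id)
open import Relation.Nullary using (¬_; Dec; does; yes; no; contradiction)
open import Relation.Nullary.Decidable using (¬?; _×-dec_; _⊎-dec_; decidable-stable)
open import Relation.Unary using (Pred; Decidable)
open import Relation.Binary.Definitions using (tri<; tri≈; tri>)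
open import Relation.Binary.PropositionalEquality
  using (_≡_; _≢_; refl; sym; trans; cong; cong₂; subst; module ≡-Reasoning)

-- Counting in finite lists.

module _ {a b r} {A : Set a} {B : Set b} (R : A → B → Set r) where

  -- Induction on `xs`: the element `y` related to the head is cut out of `ys`, and injectivity
  -- keeps it from being needed again. A relation instead of a function lets the assignments below
  -- be data types given by cases.
  length-≤-by-relation : ∀ {xs ys} → Unique xs →
    (∀ {x} → x ∈ xs → ∃ λ y → y ∈ ys × R x y) →
    (∀ {x x′ y} → R x y → R x′ y → x ≡ x′) → length xs ≤ length ys
  length-≤-by-relation {[]} _ _ _ = z≤n
  length-≤-by-relation {x ∷ xs} (x∉xs ∷ xs!) total inj with total (here refl)
  ... | y , y∈ys , Rxy with ∈-∃++ y∈ys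
  ... | as , bs , refl = begin
    suc (length xs)              ≤⟨ s≤s (length-≤-by-relation xs! total′ inj) ⟩
    suc (length (as ++ bs))      ≡⟨ cong suc (length-++ as) ⟩
    suc (length as + length bs)  ≡⟨ ℕ.+-suc (length as) (length bs) ⟨
    length as + suc (length bs)  ≡⟨ length-++ as ⟨
    length (as ++ y ∷ bs)        ∎
    where
    open ℕ.≤-Reasoning
    total′ : ∀ {x′} → x′ ∈ xs → ∃ λ y′ → y′ ∈ as ++ bs × R x′ y′
    total′ x′∈xs with total (there x′∈xs)
    ... | y′ , y′∈ , Rx′y′ with ∈-++⁻ as y′∈
    ... | inj₁ y′∈as = y′ , ∈-++⁺ˡ y′∈as , Rx′y′
    ... | inj₂ (here refl) = contradiction (inj Rxy Rx′y′) (All.lookup x∉xs x′∈xs)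
    ... | inj₂ (there y′∈bs) = y′ , ∈-++⁺ʳ as y′∈bs , Rx′y′

length-concat-maps : ∀ {a b} {A : Set a} {B : Set b} (fs : List (A → B)) xs →
  length (concat (map (λ f → map f xs) fs)) ≡ length fs * length xs
length-concat-maps [] xs = refl
length-concat-maps (f ∷ fs) xs =
  trans (length-++ (map f xs)) (cong₂ _+_ (length-map f xs) (length-concat-maps fs xs))

length-⊆ : ∀ {a} {A : Set a} {xs ys : List A} → Unique xs → (∀ {x} → x ∈ xs → x ∈ ys) →
  length xs ≤ length ys
length-⊆ xs! xs⊆ys =
  length-≤-by-relation _≡_ xs! (λ x∈xs → _ , xs⊆ys x∈xs , refl) (λ p q → trans p (sym q))

indicator : ∀ {a} {A : Set a} → Dec A → ℕ
indicator d = if does d then 1 else 0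

module _ {a p} {A : Set a} {P : Pred A p} (P? : Decidable P) where

  length-filter-sum : ∀ xs → length (filter P? xs) ≡ sum (map (indicator ∘ P?) xs)
  length-filter-sum [] = refl
  length-filter-sum (x ∷ xs) with does (P? x)
  ... | true = cong suc (length-filter-sum xs)
  ... | false = length-filter-sum xs

sum-map-+ : ∀ {a} {A : Set a} (f g : A → ℕ) xs →
  sum (map f xs) + sum (map g xs) ≡ sum (map (λ x → f x + g x) xs)
sum-map-+ f g [] = refl
sum-map-+ f g (x ∷ xs) = trans (interchange (f x) _ (g x) _) (cong (f x + g x +_) (sum-map-+ f g xs))

-- Supports of self-maps of a finite vertex set, and exchanging two maps on a subset.

module _ {n : ℕ} where

  Moved : (Fin n → Fin n) → Fin n → Set
  Moved f x = f x ≢ x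

  moved? : ∀ f → Decidable (Moved f)
  moved? f x = ¬? (f x Fin.≟ x)

  support : (Fin n → Fin n) → List (Fin n)
  support f = filter (moved? f) (allFin n)

  size : (Fin n → Fin n) → ℕ
  size f = length (support f)

  module _ {P : Pred (Fin n) 0ℓ} (P? : Decidable P) where

    ∈-filter-allFin⁺ : ∀ {x} → P x → x ∈ filter P? (allFin n)
    ∈-filter-allFin⁺ {x} = ∈-filter⁺ P? (∈-allFin x)

    ∈-filter-allFin⁻ : ∀ {x} → x ∈ filter P? (allFin n) → P x
    ∈-filter-allFin⁻ = proj₂ ∘ ∈-filter⁻ P? {xs = allFin n}

    filter-allFin-! : Unique (filter P? (allFin n))
    filter-allFin-! = Unique.filter⁺ P? (Unique.allFin⁺ n)

  module _ {P Q : Pred (Fin n) 0ℓ} (P? : Decidable P) (Q? : Decidable Q) where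

    length-filter-⊆ : (∀ {x} → P x → Q x) →
      length (filter P? (allFin n)) ≤ length (filter Q? (allFin n))
    length-filter-⊆ P⊆Q =
      length-⊆ (filter-allFin-! P?) (∈-filter-allFin⁺ Q? ∘ P⊆Q ∘ ∈-filter-allFin⁻ P?)

    length-filter-⊂ : (∀ {x} → P x → Q x) → ∀ {x} → Q x → ¬ P x →
      suc (length (filter P? (allFin n))) ≤ length (filter Q? (allFin n))
    length-filter-⊂ P⊆Q {x} Qx ¬Px = length-⊆ {xs = x ∷ _}
      (All.tabulate (λ y∈ x≡y → ¬Px (subst P (sym x≡y) (∈-filter-allFin⁻ P? y∈))) ∷ filter-allFin-! P?)
      λ { (here refl) → ∈-filter-allFin⁺ Q? Qx
        ; (there y∈) → ∈-filter-allFin⁺ Q? (P⊆Q (∈-filter-allFin⁻ P? y∈)) }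

  size-balance : ∀ f g h k →
    (∀ x → indicator (moved? f x) + indicator (moved? g x) ≡ indicator (moved? h x) + indicator (moved? k x)) →
    size f + size g ≡ size h + size k
  size-balance f g h k eq = begin
    size f + size g                                       ≡⟨ as-sum f g ⟩
    sum (map (λ x → ind f x + ind g x) (allFin n))        ≡⟨ cong sum (map-cong eq (allFin n)) ⟩
    sum (map (λ x → ind h x + ind k x) (allFin n))        ≡⟨ as-sum h k ⟨
    size h + size k                                       ∎
    where
    open ≡-Reasoning
    ind : (Fin n → Fin n) → Fin n → ℕ
    ind f = indicator ∘ moved? f
    as-sum : ∀ f g → size f + size g ≡ sum (map (λ x → ind f x + ind g x) (allFin n))
    as-sum f g = trans
      (cong₂ _+_ (length-filter-sum (moved? f) (allFin n)) (length-filter-sum (moved? g) (allFin n)))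
      (sum-map-+ (ind f) (ind g) (allFin n))

  open import Data.List.Membership.DecPropositional (Fin._≟_ {n}) public using (_∈?_)

  switchOn : List (Fin n) → (f g : Fin n → Fin n) → Fin n → Fin n
  switchOn S f g x = if does (x ∈? S) then g x else f x

  module _ {S : List (Fin n)} {f g : Fin n → Fin n} where

    switchOn-∈ : ∀ {x} → x ∈ S → switchOn S f g x ≡ g x
    switchOn-∈ {x} x∈S with x ∈? S
    ... | yes _ = refl
    ... | no x∉S = contradiction x∈S x∉S

    switchOn-∉ : ∀ {x} → x ∉ S → switchOn S f g x ≡ f x
    switchOn-∉ {x} x∉S with x ∈? S
    ... | yes x∈S = contradiction x∈S x∉S
    ... | no _ = refl

    -- At each vertex the two switched maps take the values of `f` and `g` in one order or the
    -- other, so the indicators of being moved balance pointwise.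
    size-switchOn : size (switchOn S f g) + size (switchOn S g f) ≡ size f + size g
    size-switchOn = size-balance (switchOn S f g) (switchOn S g f) f g λ x → pointwise x
      where
      pointwise : ∀ x → indicator (moved? (switchOn S f g) x) + indicator (moved? (switchOn S g f) x)
                      ≡ indicator (moved? f x) + indicator (moved? g x)
      pointwise x with does (x ∈? S)
      ... | true = ℕ.+-comm (indicator (moved? g x)) _
      ... | false = refl

-- Matchings as involutions, optimal pairs and switching.

-- A matching is encoded by the involution exchanging the ends of each of its edges; the
-- uncovered vertices are the fixed points, so size is twice the number of edges.
record Matching {n} (G : Graph n) : Set where
  field
    mate       : Fin n → Fin n
    involutive : ∀ x → mate (mate x) ≡ x
    adjacent   : ∀ {x} → mate x ≢ x → Adj G x (mate x)

  injective : ∀ {x y} → mate x ≡ mate y → x ≡ y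
  injective {x} {y} eq = trans (sym (involutive x)) (trans (cong mate eq) (involutive y))

  moved-mate : ∀ {x} → mate x ≢ x → mate (mate x) ≢ mate x
  moved-mate mx≢x eq = mx≢x (injective eq)

open Matching

module _ {n} {G : Graph n} where

  ∣_∣ : Matching G → ℕ
  ∣ P ∣ = size (mate P)

  EdgeDisjoint : Matching G → Matching G → Set
  EdgeDisjoint P Q = ∀ x → mate P x ≡ mate Q x → mate P x ≡ x

  EdgeDisjoint-sym : ∀ {P Q} → EdgeDisjoint P Q → EdgeDisjoint Q P
  EdgeDisjoint-sym d x eq = trans eq (d x (sym eq))

  -- Sizes count covered vertices, so the maxima here are twice λ₂(G) and twice α₂(G). Only first
  -- members are compared in `largest-max`; as disjointness is symmetric, this bounds both members
  -- of a pair.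
  record Optimal (P Q : Matching G) : Set where
    field
      disjoint    : EdgeDisjoint P Q
      total-max   : ∀ P′ Q′ → EdgeDisjoint P′ Q′ → ∣ P′ ∣ + ∣ Q′ ∣ ≤ ∣ P ∣ + ∣ Q ∣
      largest-max : ∀ P′ Q′ → EdgeDisjoint P′ Q′ → ∣ P ∣ + ∣ Q ∣ ≤ ∣ P′ ∣ + ∣ Q′ ∣ → ∣ P′ ∣ ≤ ∣ P ∣

  module _ (P Q : Matching G) (S : List (Fin n))
           (P-closed : ∀ {x} → x ∈ S → mate P x ∈ S) (Q-closed : ∀ {x} → x ∈ S → mate Q x ∈ S) where

    private
      p′ : Fin n → Fin n
      p′ = switchOn S (mate P) (mate Q)

    -- A set closed under both mates is a union of components of P ∪ Q, so exchanging the two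
    -- matchings inside it tears no edge apart.
    switch : Matching G
    switch .mate = p′
    switch .involutive x with x ∈? S
    ... | yes x∈S = trans (switchOn-∈ {f = mate P} {mate Q} (Q-closed x∈S)) (involutive Q x)
    ... | no x∉S = trans (switchOn-∉ {f = mate P} {mate Q} λ px∈S → x∉S (subst (_∈ S) (involutive P x) (P-closed px∈S))) (involutive P x)
    switch .adjacent {x} with x ∈? S
    ... | yes _ = adjacent Q
    ... | no _ = adjacent P

  switch-disjoint : ∀ P Q S (cP : ∀ {x} → x ∈ S → mate P x ∈ S) (cQ : ∀ {x} → x ∈ S → mate Q x ∈ S) →
    EdgeDisjoint P Q → EdgeDisjoint (switch P Q S cP cQ) (switch Q P S cQ cP)
  switch-disjoint P Q S cP cQ d x with x ∈? S
  ... | yes _ = EdgeDisjoint-sym {P} {Q} d x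
  ... | no _ = d x

  -- Alternating paths in an optimal pair.

  module _ {P Q : Matching G} (opt : Optimal P Q) where

    open Optimal opt

    private
      p q : Fin n → Fin n
      p = mate P
      q = mate Q

    -- The alternating walk from `x` that begins and ends with a Q-step, with `j + 1` steps along Q
    -- and `j` along P. Repeated vertices are allowed, since only membership in the list matters for
    -- switching.
    path : ℕ → Fin n → List (Fin n)
    path zero x = x ∷ q x ∷ []
    path (suc j) x = x ∷ q x ∷ path j (p (q x))

    end : ℕ → Fin n → Fin n
    end zero x = q x
    end (suc j) x = end j (p (q x))

    -- Every vertex of the walk is then covered by Q, so switching makes P cover all of them. The
    -- P-steps may stand still.
    QMoved : ℕ → Fin n → Set
    QMoved zero x = q x ≢ x
    QMoved (suc j) x = q x ≢ x × QMoved j (p (q x))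

    start∈path : ∀ j {x} → x ∈ path j x
    start∈path zero = here refl
    start∈path (suc j) = here refl

    Q-closed : ∀ j {x y} → y ∈ path j x → q y ∈ path j x
    Q-closed zero (here refl) = there (here refl)
    Q-closed zero (there (here refl)) = here (involutive Q _)
    Q-closed (suc j) (here refl) = there (here refl)
    Q-closed (suc j) (there (here refl)) = here (involutive Q _)
    Q-closed (suc j) (there (there y∈)) = there (there (Q-closed j y∈))

    -- The exception for the start is what the induction needs: the first vertex `p (q x)` of the
    -- tail is mated to `q x`, which is supplied by the longer walk.
    P-closed-inner : ∀ j {x y} → p (end j x) ≡ end j x → y ∈ path j x → y ≡ x ⊎ p y ∈ path j x
    P-closed-inner zero e (here refl) = inj₁ refl
    P-closed-inner zero e (there (here refl)) = inj₂ (there (here e))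
    P-closed-inner (suc j) e (here refl) = inj₁ refl
    P-closed-inner (suc j) e (there (here refl)) = inj₂ (there (there (start∈path j)))
    P-closed-inner (suc j) e (there (there y∈)) with P-closed-inner j e y∈
    ... | inj₁ refl = inj₂ (there (here (involutive P _)))
    ... | inj₂ py∈ = inj₂ (there (there py∈))

    P-closed : ∀ j {x y} → p x ≡ x → p (end j x) ≡ end j x → y ∈ path j x → p y ∈ path j x
    P-closed j s e y∈ with P-closed-inner j e y∈
    ... | inj₁ refl = subst (_∈ path j _) (sym s) y∈
    ... | inj₂ py∈ = py∈

    path-moved : ∀ j {x y} → QMoved j x → y ∈ path j x → q y ≢ y
    path-moved zero m (here refl) = m
    path-moved zero m (there (here refl)) = moved-mate Q m
    path-moved (suc j) (m , _) (here refl) = m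
    path-moved (suc j) (m , _) (there (here refl)) = moved-mate Q m
    path-moved (suc j) (_ , ms) (there (there y∈)) = path-moved j ms y∈

    -- Switching P and Q along such a path would enlarge P and keep the total.
    no-augmenting-path : ∀ j {x} → QMoved j x → p x ≡ x → p (end j x) ≢ end j x
    no-augmenting-path j {x} ms s e =
      ℕ.<⇒≱ bigger (largest-max P′ Q′ (switch-disjoint P Q S cP cQ disjoint) (ℕ.≤-reflexive (sym (size-switchOn {S = S} {p} {q}))))
      where
      S = path j x
      cP : ∀ {y} → y ∈ S → p y ∈ S
      cP = P-closed j s e
      cQ : ∀ {y} → y ∈ S → q y ∈ S
      cQ = Q-closed j
      P′ = switch P Q S cP cQ
      Q′ = switch Q P S cQ cP
      moved′ : ∀ {y} → y ∈ S → mate P′ y ≢ y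
      moved′ y∈S rewrite switchOn-∈ {f = p} {g = q} y∈S = path-moved j ms y∈S
      moved-mono : ∀ {y} → p y ≢ y → mate P′ y ≢ y
      moved-mono {y} m with y ∈? S
      ... | yes y∈S = path-moved j ms y∈S
      ... | no _ = m
      bigger : suc ∣ P ∣ ≤ ∣ P′ ∣
      bigger = length-filter-⊂ (moved? p) (moved? (mate P′)) moved-mono (moved′ (start∈path j)) (contradiction s)

  -- The inequality for pairs that no relinking can improve.

  Stable : (M P Q : Matching G) → Set
  Stable M P Q = ∀ {x} → mate M x ≢ x → mate P x ≡ x → mate Q x ≡ mate M x

  module _ {M P Q : Matching G} (opt : Optimal P Q) (stableP : Stable M P Q) (stableQ : Stable M Q P) where

    private
      m p q : Fin n → Fin n
      m = mate M
      p = mate P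
      q = mate Q

    -- By `q-moved` and `pq-covered` below, these are the M-covered ends, missed by P, of paths in P
    -- ∪ Q with at least three edges.
    Long : Fin n → Set
    Long x = m x ≢ x × p x ≡ x × q (p (q x)) ≢ p (q x)

    long? : Decidable Long
    long? x = ¬? (m x Fin.≟ x) ×-dec p x Fin.≟ x ×-dec ¬? (q (p (q x)) Fin.≟ p (q x))

    longs : List (Fin n)
    longs = filter long? (allFin n)

    -- A vertex covered by both M and P is charged to itself, the start of a path of length two to
    -- the other end of that path, a long vertex to its own copy under `inj₂`. Coverage by M tells
    -- the first two kinds of target apart. The equation for `w` is a field so that matching never
    -- has to unify an index with `p (q x)`.
    data Charge (x : Fin n) : Fin n ⊎ Fin n → Set where
      covered : m x ≢ x → Charge x (inj₁ x)
      short   : ∀ {w} → m w ≡ w → w ≡ p (q x) → Charge x (inj₁ w)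
      long    : Charge x (inj₂ x)

    Charge-injective : ∀ {x x′ y} → Charge x y → Charge x′ y → x ≡ x′
    Charge-injective (covered _) (covered _) = refl
    Charge-injective (covered mx≢x) (short mx≡x _) = contradiction mx≡x mx≢x
    Charge-injective (short mx≡x _) (covered mx≢x) = contradiction mx≡x mx≢x
    Charge-injective (short _ refl) (short _ eq) = injective Q (injective P eq)
    Charge-injective long long = refl

    q-moved : ∀ {x} → m x ≢ x → p x ≡ x → q x ≢ x
    q-moved mx≢x px≡x qx≡x = mx≢x (trans (sym (stableP mx≢x px≡x)) qx≡x)

    -- Otherwise the single Q-edge at `x` could be moved over to P.
    pq-covered : ∀ {x} → m x ≢ x → p x ≡ x → p (q x) ≢ q x
    pq-covered mx≢x px≡x = no-augmenting-path opt 0 (q-moved mx≢x px≡x) px≡x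

    -- Let w be `p (q x)`. If M covered w, `stableQ` would make the P-edge from w to `q x` an edge
    -- of M. But `q x` is the M-mate of `x`, so w would be `x`, which P leaves uncovered.
    short-end : ∀ {x} → m x ≢ x → p x ≡ x → q (p (q x)) ≡ p (q x) → m (p (q x)) ≡ p (q x)
    short-end {x} mx≢x px≡x qw≡w = decidable-stable (m (p (q x)) Fin.≟ p (q x)) λ mw≢w →
      let mw≡mx = trans (sym (stableQ mw≢w qw≡w)) (trans (involutive P (q x)) (stableP mx≢x px≡x))
          pw≡px = cong p (injective M mw≡mx)
      in q-moved mx≢x px≡x (trans (sym (involutive P (q x))) (trans pw≡px px≡x))

    charge : ∀ {x} → x ∈ support m → ∃ λ y → y ∈ map inj₁ (support p) ++ map inj₂ longs × Charge x y
    charge {x} x∈ with ∈-filter-allFin⁻ (moved? m) x∈ | p x Fin.≟ x | q (p (q x)) Fin.≟ p (q x)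
    ... | mx≢x | no px≢x | _ =
      _ , ∈-++⁺ˡ (∈-map⁺ inj₁ (∈-filter-allFin⁺ (moved? p) px≢x)) , covered mx≢x
    -- The path stops at `p (q x)`, which is covered by P and, by `short-end`, not by M.
    ... | mx≢x | yes px≡x | yes qw≡w =
      _ , ∈-++⁺ˡ (∈-map⁺ inj₁ (∈-filter-allFin⁺ (moved? p) (moved-mate P (pq-covered mx≢x px≡x))))
        , short (short-end mx≢x px≡x qw≡w) refl
    ... | mx≢x | yes px≡x | no qw≢w =
      _ , ∈-++⁺ʳ (map inj₁ (support p)) (∈-map⁺ inj₂ (∈-filter-allFin⁺ long? (mx≢x , px≡x , qw≢w))) , long

    size-M : ∣ M ∣ ≤ ∣ P ∣ + length longs
    size-M = begin
      ∣ M ∣                                              ≤⟨ length-≤-by-relation Charge (filter-allFin-! (moved? m)) charge Charge-injective ⟩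
      length (map inj₁ (support p) ++ map inj₂ longs)    ≡⟨ length-++ (map inj₁ (support p)) ⟩
      length (map {B = Fin n ⊎ Fin n} inj₁ (support p)) + length (map {B = Fin n ⊎ Fin n} inj₂ longs)
        ≡⟨ cong₂ _+_ (length-map inj₁ (support p)) (length-map inj₂ longs) ⟩
      ∣ P ∣ + length longs                               ∎
      where open ℕ.≤-Reasoning

    qpq-covered : ∀ x → Long x → p (q (p (q x))) ≢ q (p (q x))
    qpq-covered x (mx≢x , px≡x , qw≢w) = no-augmenting-path opt 1 (q-moved mx≢x px≡x , qw≢w) px≡x

    moved-back : ∀ {x y} → q y ≡ x → q x ≢ x → q y ≢ y
    moved-back qy≡x qx≢x qy≡y = qx≢x (trans (cong q (trans (sym qy≡x) qy≡y)) qy≡x)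

    q-swap : ∀ {x y} → q y ≡ x → y ≡ q x
    q-swap qy≡x = trans (sym (involutive Q _)) (cong q qy≡x)

    p-swap : ∀ {x y} → p y ≡ x → y ≡ p x
    p-swap py≡x = trans (sym (involutive P _)) (cong p py≡x)

    -- A walk of five steps between two long vertices would be augmenting. Its last Q-edge is
    -- genuine because, read backwards, it is the first edge of the walk from `x`.
    no-path₅ : ∀ x y → Long x → Long y → q (p (q (p (q y)))) ≢ x
    no-path₅ x y (mx≢x , px≡x , _) (my≢y , py≡y , qw≢w) e =
      no-augmenting-path opt 2 (q-moved my≢y py≡y , qw≢w , moved-back e (q-moved mx≢x px≡x)) py≡y
        (trans (cong p e) (trans px≡x (sym e)))

    -- The same with seven steps: read backwards, the last two Q-edges are the first two of the walk
    -- from `x`, and both are genuine because `x` is long.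
    no-path₇ : ∀ x y → Long x → Long y → q (p (q (p (q (p (q y)))))) ≢ x
    no-path₇ x y (mx≢x , px≡x , qv≢v) (my≢y , py≡y , qw≢w) e =
      no-augmenting-path opt 3
        (q-moved my≢y py≡y , qw≢w , moved-back (p-swap (q-swap e)) qv≢v , moved-back e (q-moved mx≢x px≡x)) py≡y
        (trans (cong p e) (trans px≡x (sym e)))

    disjoint-images : (f g : Fin n → Fin n) → (∀ x y → Long x → Long y → f x ≢ g y) → Disjoint (map f longs) (map g longs)
    disjoint-images f g f≢g (∈f , ∈g) with ∈-map⁻ f ∈f | ∈-map⁻ g ∈g
    ... | x , x∈ , eq | y , y∈ , eq′ = f≢g x y (∈-filter-allFin⁻ long? x∈) (∈-filter-allFin⁻ long? y∈) (trans (sym eq) eq′)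

    f₁ f₂ f₃ f₄ : Fin n → Fin n
    f₁ x = q x
    f₂ x = p (q x)
    f₃ x = q (p (q x))
    f₄ x = p (q (p (q x)))

    images : List (List (Fin n))
    images = map (λ f → map f longs) (f₁ ∷ f₂ ∷ f₃ ∷ f₄ ∷ [])

    -- Cancelling `q` and `p` in an equation between images of `x` and `y` leaves `x` as the vertex
    -- two, three, five or seven steps along the walk from `y`. In the first two cases that vertex
    -- is covered by P while `x` is not; the others are `no-path₅` and `no-path₇`.
    images-! : Unique (concat images)
    images-! = Unique.concat⁺
      ( Unique.map⁺ (injective Q) longs-!
      ∷ Unique.map⁺ (injective Q ∘ injective P) longs-!
      ∷ Unique.map⁺ (injective Q ∘ injective P ∘ injective Q) longs-!
      ∷ Unique.map⁺ (injective Q ∘ injective P ∘ injective Q ∘ injective P) longs-!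
      ∷ [] )
      ( ( disjoint-images f₁ f₂ (λ x y Lx Ly eq → qpq-≢ x y Lx Ly (q-swap eq))
        ∷ disjoint-images f₁ f₃ (λ x y Lx Ly eq → pq-≢ x y Lx Ly (injective Q eq))
        ∷ disjoint-images f₁ f₄ (λ x y Lx Ly eq → no-path₅ x y Lx Ly (sym (q-swap eq)))
        ∷ [])
      ∷ ( disjoint-images f₂ f₃ (λ x y Lx Ly eq → no-path₅ x y Lx Ly (sym (q-swap (p-swap eq))))
        ∷ disjoint-images f₂ f₄ (λ x y Lx Ly eq → pq-≢ x y Lx Ly (injective Q (injective P eq)))
        ∷ [])
      ∷ ( disjoint-images f₃ f₄ (λ x y Lx Ly eq → no-path₇ x y Lx Ly (sym (q-swap (p-swap (q-swap eq)))))
        ∷ [])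
      ∷ [] ∷ [] )
      where
      longs-! = filter-allFin-! long?
      pq-≢ : ∀ x y → Long x → Long y → x ≢ p (q y)
      pq-≢ _ _ (_ , px≡x , _) (my≢y , py≡y , _) refl = moved-mate P (pq-covered my≢y py≡y) px≡x
      qpq-≢ : ∀ x y → Long x → Long y → x ≢ q (p (q y))
      qpq-≢ _ _ (_ , px≡x , _) Ly refl = qpq-covered _ Ly px≡x

    images-covered : All (All (_∈ support p)) images
    images-covered =
        covered-image f₁ (λ _ (mx≢x , px≡x , _) → pq-covered mx≢x px≡x)
      ∷ covered-image f₂ (λ _ (mx≢x , px≡x , _) → moved-mate P (pq-covered mx≢x px≡x))
      ∷ covered-image f₃ qpq-covered
      ∷ covered-image f₄ (λ x → moved-mate P ∘ qpq-covered x)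
      ∷ []
      where
      covered-image : ∀ f → (∀ x → Long x → p (f x) ≢ f x) → All (_∈ support p) (map f longs)
      covered-image f c = All.map⁺ (All.tabulate (∈-filter-allFin⁺ (moved? p) ∘ c _ ∘ ∈-filter-allFin⁻ long?))

    four-longs : 4 * length longs ≤ ∣ P ∣
    four-longs = begin
      4 * length longs
        ≡⟨ length-concat-maps (f₁ ∷ f₂ ∷ f₃ ∷ f₄ ∷ []) longs ⟨
      length (concat images)
        ≤⟨ length-⊆ images-! (All.lookup (All.concat⁺ images-covered)) ⟩
      ∣ P ∣ ∎
      where open ℕ.≤-Reasoning

    stable-bound : 4 * ∣ M ∣ ≤ 5 * ∣ P ∣
    stable-bound = begin
      4 * ∣ M ∣                       ≤⟨ ℕ.*-monoʳ-≤ 4 size-M ⟩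
      4 * (∣ P ∣ + length longs)      ≡⟨ ℕ.*-distribˡ-+ 4 ∣ P ∣ (length longs) ⟩
      4 * ∣ P ∣ + 4 * length longs    ≤⟨ ℕ.+-monoʳ-≤ (4 * ∣ P ∣) four-longs ⟩
      4 * ∣ P ∣ + ∣ P ∣               ≡⟨ ℕ.+-comm (4 * ∣ P ∣) ∣ P ∣ ⟩
      5 * ∣ P ∣                       ∎
      where open ℕ.≤-Reasoning

  -- Relinking: trading an edge of P for an edge of M.

  module Relink (M P Q : Matching G) (disjoint : EdgeDisjoint P Q) {u : Fin n}
                (mu≢u : mate M u ≢ u) (pu≡u : mate P u ≡ u) (qu≢mu : mate Q u ≢ mate M u) where

    private
      m p q : Fin n → Fin n
      m = mate M
      p = mate P
      q = mate Q
      v : Fin n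
      v = m u

    -- The M-edge from `u` to `v` enters P, and the P-edge at `v`, if there is one, leaves. Nothing
    -- has to leave at `u`, which P misses, so the size does not drop.
    relinked : Fin n → Fin n
    -- `v` is tested before `p v` because the two coincide when P misses `v`.
    relinked x with x Fin.≟ u | x Fin.≟ v | x Fin.≟ p v
    ... | yes _ | _     | _     = v
    ... | no _  | yes _ | _     = u
    ... | no _  | no _  | yes _ = x
    ... | no _  | no _  | no _  = p x

    -- Indexed by the value of `relinked x`, so that abstracting it together with `view x` replaces
    -- the three tests by one case split.
    data View (x : Fin n) : Fin n → Set where
      at-u  : x ≡ u → View x v
      at-v  : x ≢ u → x ≡ v → View x u
      freed : x ≢ u → x ≢ v → x ≡ p v → View x x
      other : x ≢ u → x ≢ v → x ≢ p v → View x (p x)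

    view : ∀ x → View x (relinked x)
    view x with x Fin.≟ u | x Fin.≟ v | x Fin.≟ p v
    ... | yes a | _     | _     = at-u a
    ... | no a  | yes b | _     = at-v a b
    ... | no a  | no b  | yes c = freed a b c
    ... | no a  | no b  | no c  = other a b c

    relinked-u : relinked u ≡ v
    relinked-u with relinked u | view u
    ... | _ | at-u _ = refl
    ... | _ | at-v u≢u _ = contradiction refl u≢u
    ... | _ | freed u≢u _ _ = contradiction refl u≢u
    ... | _ | other u≢u _ _ = contradiction refl u≢u

    relinked-v : relinked v ≡ u
    relinked-v with relinked v | view v
    ... | _ | at-u v≡u = contradiction v≡u mu≢u
    ... | _ | at-v _ _ = refl
    ... | _ | freed _ v≢v _ = contradiction refl v≢v
    ... | _ | other _ v≢v _ = contradiction refl v≢v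

    relinked-other : ∀ {x} → x ≢ u → x ≢ v → x ≢ p v → relinked x ≡ p x
    relinked-other {x} a b c with relinked x | view x
    ... | _ | at-u e = contradiction e a
    ... | _ | at-v _ e = contradiction e b
    ... | _ | freed _ _ e = contradiction e c
    ... | _ | other _ _ _ = refl

    matching : Matching G
    matching .mate = relinked
    matching .involutive x with relinked x in eq | view x
    ... | _ | at-u refl = relinked-v
    ... | _ | at-v _ refl = relinked-u
    ... | _ | freed _ _ _ = eq
    ... | _ | other x≢u x≢v x≢pv = trans
      (relinked-other
        (λ px≡u → x≢u (injective P (trans px≡u (sym pu≡u))))
        (λ px≡v → x≢pv (trans (sym (involutive P x)) (cong p px≡v)))
        (λ px≡pv → x≢v (injective P px≡pv)))
      (involutive P x)
    matching .adjacent {x} r with relinked x | view x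
    ... | _ | at-u refl = adjacent M mu≢u
    ... | _ | at-v _ refl = Adj-sym G (adjacent M mu≢u)
    ... | _ | freed _ _ _ = contradiction refl r
    ... | _ | other _ _ _ = adjacent P r

    matching-disjoint : EdgeDisjoint matching Q
    matching-disjoint x eq with relinked x | view x
    ... | _ | at-u refl = contradiction (sym eq) qu≢mu
    ... | _ | at-v _ refl = contradiction (trans (cong q eq) (involutive Q _)) qu≢mu
    ... | _ | freed _ _ _ = refl
    ... | _ | other _ _ _ = disjoint x eq

    -- Only the old mate of `v` can lose its cover; it is charged to `u`, a target that is free
    -- because P misses it.
    data Transfer (x : Fin n) : Fin n → Set where
      moveTo-u : x ≡ p v → Transfer x u
      stay     : p x ≢ x → Transfer x x

    Transfer-injective : ∀ {x x′ y} → Transfer x y → Transfer x′ y → x ≡ x′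
    Transfer-injective (moveTo-u e) (moveTo-u e′) = trans e (sym e′)
    Transfer-injective (moveTo-u _) (stay pu≢u) = contradiction pu≡u pu≢u
    Transfer-injective (stay pu≢u) (moveTo-u _) = contradiction pu≡u pu≢u
    Transfer-injective (stay _) (stay _) = refl

    transfer : ∀ {x} → p x ≢ x → ∃ λ y → relinked y ≢ y × Transfer x y
    transfer {x} px≢x with relinked x in eq | view x
    ... | _ | at-u refl = contradiction pu≡u px≢x
    ... | _ | at-v x≢u refl = x , (λ e → x≢u (trans (sym e) eq)) , stay px≢x
    ... | _ | freed _ _ x≡pv = u , (λ e → mu≢u (trans (sym relinked-u) e)) , moveTo-u x≡pv
    ... | _ | other _ _ _ = x , (λ e → px≢x (trans (sym eq) e)) , stay px≢x

    matching-size : ∣ P ∣ ≤ ∣ matching ∣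
    matching-size = length-≤-by-relation Transfer (filter-allFin-! (moved? p))
      (λ x∈ → let y , ry≢y , t = transfer (∈-filter-allFin⁻ (moved? p) x∈)
              in y , ∈-filter-allFin⁺ (moved? relinked) ry≢y , t)
      Transfer-injective

  -- Raising the overlap with M until no relinking is left.

  module _ (M : Matching G) where

    Shared : Matching G → Matching G → Fin n → Set
    Shared P Q x = mate M x ≢ x × (mate P x ≡ mate M x ⊎ mate Q x ≡ mate M x)

    shared? : ∀ P Q → Decidable (Shared P Q)
    shared? P Q x = ¬? (mate M x Fin.≟ x) ×-dec (mate P x Fin.≟ mate M x ⊎-dec mate Q x Fin.≟ mate M x)

    -- Twice the number of edges in M ∩ (P ∪ Q); the potential for the induction.
    sharedSize : Matching G → Matching G → ℕ
    sharedSize P Q = length (filter (shared? P Q) (allFin n))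

    sharedSize-comm : ∀ P Q → sharedSize P Q ≤ sharedSize Q P
    sharedSize-comm P Q = length-filter-⊆ (shared? P Q) (shared? Q P) λ (mx≢x , s) → mx≢x , Sum.swap s

    sharedSize-≤ : ∀ P Q → sharedSize P Q ≤ n
    sharedSize-≤ P Q = ℕ.≤-trans (length-filter (shared? P Q) (allFin n)) (ℕ.≤-reflexive (length-tabulate id))

    -- The M-edge at the M-mate of `u` leads to `u`, which P misses, so the P-edge dropped there is
    -- not in M; the edge gained was in neither matching.
    relink-sharedSize : ∀ P Q (d : EdgeDisjoint P Q) {u} (mu≢u : mate M u ≢ u) (pu≡u : mate P u ≡ u)
      (qu≢mu : mate Q u ≢ mate M u) →
      suc (sharedSize P Q) ≤ sharedSize (Relink.matching M P Q d mu≢u pu≡u qu≢mu) Q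
    relink-sharedSize P Q d {u} mu≢u pu≡u qu≢mu =
      length-filter-⊂ (shared? P Q) (shared? matching Q) shared-mono
        (mu≢u , inj₁ relinked-u) λ { (_ , inj₁ pu≡mu) → mu≢u (trans (sym pu≡mu) pu≡u) ; (_ , inj₂ qu≡mu) → qu≢mu qu≡mu }
      where
      open Relink M P Q d mu≢u pu≡u qu≢mu
      shared-mono : ∀ {x} → Shared P Q x → Shared matching Q x
      shared-mono (mx≢x , inj₂ qx≡mx) = mx≢x , inj₂ qx≡mx
      shared-mono {x} (mx≢x , inj₁ px≡mx) with relinked x in eq | view x
      ... | _ | at-u refl = mx≢x , inj₁ refl
      ... | _ | at-v _ refl = mx≢x , inj₁ (sym (involutive M u))
      -- Here `x` is `p v`; were its P-edge in M, `x` would be the M-mate of `v`, that is `u`.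
      ... | _ | freed x≢u _ refl =
        contradiction (injective M (trans (sym px≡mx) (involutive P _))) x≢u
      ... | _ | other _ _ _ = mx≢x , inj₁ px≡mx

    Unstable : Matching G → Matching G → Fin n → Set
    Unstable P Q x = mate M x ≢ x × mate P x ≡ x × mate Q x ≢ mate M x

    unstable? : ∀ P Q → Decidable (Unstable P Q)
    unstable? P Q x = ¬? (mate M x Fin.≟ x) ×-dec mate P x Fin.≟ x ×-dec ¬? (mate Q x Fin.≟ mate M x)

    ¬unstable⇒stable : ∀ P Q → ¬ ∃ (Unstable P Q) → Stable M P Q
    ¬unstable⇒stable P Q ¬u {x} mx≢x px≡x =
      decidable-stable (mate Q x Fin.≟ mate M x) λ qx≢mx → ¬u (x , mx≢x , px≡x , qx≢mx)

    Optimal-resp : ∀ P Q P′ Q′ → Optimal P Q → EdgeDisjoint P′ Q′ → ∣ P ∣ ≤ ∣ P′ ∣ → ∣ Q ∣ ≤ ∣ Q′ ∣ →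
      Optimal P′ Q′
    Optimal-resp P Q P′ Q′ opt d p≤ q≤ = record
      { disjoint = d
      ; total-max = λ P″ Q″ d″ → ℕ.≤-trans (total-max P″ Q″ d″) (ℕ.+-mono-≤ p≤ q≤)
      ; largest-max = λ P″ Q″ d″ ≤total → ℕ.≤-trans (largest-max P″ Q″ d″ (ℕ.≤-trans (ℕ.+-mono-≤ p≤ q≤) ≤total)) p≤
      }
      where open Optimal opt

    -- Each instability allows a relinking that increases sharedSize, which is at most n.
    optimal-bound : ∀ k {P Q} → Optimal P Q → n ≤ sharedSize P Q + k → 4 * ∣ M ∣ ≤ 5 * ∣ P ∣
    improved-bound : ∀ k {P Q P′ Q′} → Optimal P Q → EdgeDisjoint P′ Q′ → ∣ P ∣ ≤ ∣ P′ ∣ → ∣ Q ∣ ≤ ∣ Q′ ∣ →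
      suc (sharedSize P Q) ≤ sharedSize P′ Q′ → n ≤ sharedSize P Q + k → 4 * ∣ M ∣ ≤ 5 * ∣ P ∣

    -- With `k` equal to zero all `n` vertices are shared already, so there is no room for the
    -- increase.
    improved-bound zero {P} {Q} {P′} {Q′} _ _ _ _ more n≤ = contradiction
      (ℕ.≤-trans more (ℕ.≤-trans (sharedSize-≤ P′ Q′) (ℕ.≤-trans n≤ (ℕ.≤-reflexive (ℕ.+-identityʳ _)))))
      (ℕ.<-irrefl refl)
    improved-bound (suc k) {P} {Q} {P′} {Q′} opt d p≤ q≤ more n≤ = ℕ.≤-trans
      (optimal-bound k (Optimal-resp P Q P′ Q′ opt d p≤ q≤)
        (ℕ.≤-trans n≤ (ℕ.≤-trans (ℕ.≤-reflexive (ℕ.+-suc _ k)) (ℕ.+-monoˡ-≤ k more))))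
      -- `largest-max` bounds the new first matching by the old one, so the bound obtained for the
      -- new pair comes back to P.
      (ℕ.*-monoʳ-≤ 5 (Optimal.largest-max opt P′ Q′ d (ℕ.+-mono-≤ p≤ q≤)))

    optimal-bound k {P} {Q} opt n≤ with Fin.any? (unstable? P Q) | Fin.any? (unstable? Q P)
    ... | yes (u , mu≢u , pu≡u , qu≢mu) | _ =
      improved-bound k {P} {Q} {P′ = matching} {Q} opt matching-disjoint matching-size ℕ.≤-refl
        (relink-sharedSize P Q disjoint mu≢u pu≡u qu≢mu) n≤
      where
      open Optimal opt
      open Relink M P Q disjoint mu≢u pu≡u qu≢mu
    ... | no _ | yes (u , mu≢u , qu≡u , pu≢mu) =
      improved-bound k {P} {Q} {P′ = P} {matching} opt (EdgeDisjoint-sym {matching} {P} matching-disjoint) ℕ.≤-refl matching-size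
        (ℕ.≤-trans (s≤s (sharedSize-comm P Q)) (ℕ.≤-trans
          (relink-sharedSize Q P (EdgeDisjoint-sym {P} {Q} disjoint) mu≢u qu≡u pu≢mu) (sharedSize-comm matching P))) n≤
      where
      open Optimal opt
      open Relink M Q P (EdgeDisjoint-sym {P} {Q} disjoint) mu≢u qu≡u pu≢mu
    ... | no sP | no sQ = stable-bound {M} opt (¬unstable⇒stable P Q sP) (¬unstable⇒stable Q P sQ)

-- Translation between edge lists and involutions.

endpoints-left : ∀ {n} {M : List (Edge n)} {u v} → (u , v) ∈ M → u ∈ endpoints M
endpoints-left (here refl) = here refl
endpoints-left {M = _ ∷ _} (there e∈M) = there (there (endpoints-left e∈M))

endpoints-right : ∀ {n} {M : List (Edge n)} {u v} → (u , v) ∈ M → v ∈ endpoints M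
endpoints-right (here refl) = there (here refl)
endpoints-right {M = _ ∷ _} (there e∈M) = there (there (endpoints-right e∈M))

length-endpoints : ∀ {n} (M : List (Edge n)) → length (endpoints M) ≡ 2 * length M
length-endpoints [] = refl
length-endpoints (e ∷ M) = trans (cong (suc ∘ suc) (length-endpoints M)) (sym (ℕ.*-suc 2 (length M)))

partner : ∀ {n} → List (Edge n) → Fin n → Fin n
partner [] x = x
partner ((u , v) ∷ M) x with x Fin.≟ u | x Fin.≟ v
... | yes _ | _     = v
... | no _  | yes _ = u
... | no _  | no _  = partner M x

module _ {n} {u v : Fin n} where

  partner-left : ∀ {M} → Unique (endpoints M) → (u , v) ∈ M → partner M u ≡ v
  partner-left {(u′ , v′) ∷ M} M! (here refl) with u Fin.≟ u
  ... | yes _ = refl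
  ... | no u≢u = contradiction refl u≢u
  partner-left {(u′ , v′) ∷ M} ((_ ∷ u′∉) ∷ v′∉ ∷ M!) (there e∈M) with u Fin.≟ u′ | u Fin.≟ v′
  ... | yes refl | _ = contradiction refl (All.lookup u′∉ (endpoints-left e∈M))
  ... | no _ | yes refl = contradiction refl (All.lookup v′∉ (endpoints-left e∈M))
  ... | no _ | no _ = partner-left M! e∈M

  partner-right : ∀ {M} → Unique (endpoints M) → (u , v) ∈ M → partner M v ≡ u
  partner-right {(u′ , v′) ∷ M} ((u≢v ∷ _) ∷ _) (here refl) with v Fin.≟ u | v Fin.≟ v
  ... | yes refl | _ = contradiction refl u≢v
  ... | no _ | yes _ = refl
  ... | no _ | no v≢v = contradiction refl v≢v
  partner-right {(u′ , v′) ∷ M} ((_ ∷ u′∉) ∷ v′∉ ∷ M!) (there e∈M) with v Fin.≟ u′ | v Fin.≟ v′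
  ... | yes refl | _ = contradiction refl (All.lookup u′∉ (endpoints-right e∈M))
  ... | no _ | yes refl = contradiction refl (All.lookup v′∉ (endpoints-right e∈M))
  ... | no _ | no _ = partner-right M! e∈M

-- A mate can arise in two ways, since edges are stored as ordered pairs and `x` may be either end.
data Mated {n} (M : List (Edge n)) (x : Fin n) : Fin n → Set where
  unmated : x ∉ endpoints M → Mated M x x
  left    : ∀ {y} → (x , y) ∈ M → Mated M x y
  right   : ∀ {y} → (y , x) ∈ M → Mated M x y

mated : ∀ {n} (M : List (Edge n)) x → Mated M x (partner M x)
mated [] x = unmated λ ()
mated ((u , v) ∷ M) x with x Fin.≟ u | x Fin.≟ v
... | yes refl | _ = left (here refl)
... | no _ | yes refl = right (here refl)
... | no x≢u | no x≢v with partner M x | mated M x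
... | _ | unmated x∉ = unmated λ { (here x≡u) → x≢u x≡u ; (there (here x≡v)) → x≢v x≡v ; (there (there x∈)) → x∉ x∈ }
... | _ | left e∈M = left (there e∈M)
... | _ | right e∈M = right (there e∈M)

module _ {n} {G : Graph n} where

  size-endpoints : ∀ (P : Matching G) M → Unique (endpoints M) → (∀ {x} → mate P x ≢ x → x ∈ endpoints M) →
    (∀ {x} → x ∈ endpoints M → mate P x ≢ x) → ∣ P ∣ ≡ 2 * length M
  size-endpoints P M M! ⊆ ⊇ = trans
    (ℕ.≤-antisym
      (length-⊆ (filter-allFin-! (moved? (mate P))) (⊆ ∘ ∈-filter-allFin⁻ (moved? (mate P))))
      (length-⊆ M! (∈-filter-allFin⁺ (moved? (mate P)) ∘ ⊇)))
    (length-endpoints M)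

  module _ {M : List (Edge n)} (isM : IsMatching G M) where

    private
      M! : Unique (endpoints M)
      M! = proj₂ isM
      edge : ∀ {e} → e ∈ M → IsEdge G e
      edge = All.lookup (proj₁ isM)

    fromList : Matching G
    fromList .mate = partner M
    fromList .involutive x with partner M x in eq | mated M x
    ... | _ | unmated _ = eq
    ... | _ | left e∈M = partner-right M! e∈M
    ... | _ | right e∈M = partner-left M! e∈M
    fromList .adjacent {x} r with partner M x | mated M x
    ... | _ | unmated _ = contradiction refl r
    ... | _ | left e∈M = proj₂ (edge e∈M)
    ... | _ | right e∈M = Adj-sym G (proj₂ (edge e∈M))

    size-fromList : ∣ fromList ∣ ≡ 2 * length M
    size-fromList = size-endpoints fromList M M! moved⇒∈ ∈⇒moved
      where
      moved⇒∈ : ∀ {x} → partner M x ≢ x → x ∈ endpoints M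
      moved⇒∈ {x} r with partner M x | mated M x
      ... | _ | unmated _ = contradiction refl r
      ... | _ | left e∈M = endpoints-left e∈M
      ... | _ | right e∈M = endpoints-right e∈M
      ∈⇒moved : ∀ {x} → x ∈ endpoints M → partner M x ≢ x
      ∈⇒moved {x} x∈ with partner M x | mated M x
      ... | _ | unmated x∉ = contradiction x∈ x∉
      ... | _ | left e∈M = λ { refl → Fin.<-irrefl refl (proj₁ (edge e∈M)) }
      ... | _ | right e∈M = λ { refl → Fin.<-irrefl refl (proj₁ (edge e∈M)) }

  -- A common edge would occur in both lists as the same pair: opposite orientations would make each
  -- end smaller than the other.
  fromList-disjoint : ∀ {H H′} ((isH , isH′ , _) : InB2 G H H′) → EdgeDisjoint (fromList isH) (fromList isH′)
  fromList-disjoint {H} {H′} (isH , isH′ , H∩H′) x eq with partner H x | mated H x | partner H′ x | mated H′ x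
  ... | _ | unmated _ | _ | _ = refl
  fromList-disjoint _ x refl | _ | left _ | _ | unmated _ = refl
  fromList-disjoint (_ , _ , H∩H′) x refl | _ | left e∈H | _ | left e∈H′ = contradiction e∈H′ (H∩H′ _ e∈H)
  fromList-disjoint (isH , isH′ , _) x refl | _ | left e∈H | _ | right e∈H′ =
    contradiction (proj₁ (All.lookup (proj₁ isH′) e∈H′)) (Fin.<-asym (proj₁ (All.lookup (proj₁ isH) e∈H)))
  fromList-disjoint _ x refl | _ | right _ | _ | unmated _ = refl
  fromList-disjoint (isH , isH′ , _) x refl | _ | right e∈H | _ | left e∈H′ =
    contradiction (proj₁ (All.lookup (proj₁ isH′) e∈H′)) (Fin.<-asym (proj₁ (All.lookup (proj₁ isH) e∈H)))
  fromList-disjoint (_ , _ , H∩H′) x refl | _ | right e∈H | _ | right e∈H′ = contradiction e∈H′ (H∩H′ _ e∈H)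

  module _ (P : Matching G) where

    private
      p : Fin n → Fin n
      p = mate P

    lower? : Decidable (λ x → x < p x)
    lower? x = x Fin.<? p x

    withMates : List (Fin n) → List (Edge n)
    withMates = map (λ x → x , p x)

    toList : List (Edge n)
    toList = withMates (filter lower? (allFin n))

    ∈-toList⁺ : ∀ {x} → x < p x → (x , p x) ∈ toList
    ∈-toList⁺ x<px = ∈-map⁺ (λ x → x , p x) (∈-filter-allFin⁺ lower? x<px)

    ∈-toList⁻ : ∀ {u v} → (u , v) ∈ toList → u < p u × v ≡ p u
    ∈-toList⁻ e∈ with ∈-map⁻ (λ x → x , p x) e∈
    ... | _ , x∈ , refl = ∈-filter-allFin⁻ lower? x∈ , refl

    ∈-endpoints-withMates : ∀ {xs y} → y ∈ endpoints (withMates xs) → ∃ λ x → x ∈ xs × (y ≡ x ⊎ y ≡ p x)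
    ∈-endpoints-withMates {x ∷ xs} (here refl) = x , here refl , inj₁ refl
    ∈-endpoints-withMates {x ∷ xs} (there (here refl)) = x , here refl , inj₂ refl
    ∈-endpoints-withMates {x ∷ xs} (there (there y∈)) with ∈-endpoints-withMates y∈
    ... | x′ , x′∈xs , y≡ = x′ , there x′∈xs , y≡

    -- A listed vertex lies below its mate, so it cannot be the mate of another listed vertex; and
    -- distinct vertices have distinct mates.
    endpoints-withMates-! : ∀ {xs} → Unique xs → All (λ x → x < p x) xs → Unique (endpoints (withMates xs))
    endpoints-withMates-! {[]} _ _ = []
    endpoints-withMates-! {x ∷ xs} (x∉xs ∷ xs!) (x<px ∷ xs<) =
      ((λ x≡px → Fin.<-irrefl x≡px x<px) ∷ All.tabulate (λ y∈ x≡y → x∉ (subst (_∈ _) (sym x≡y) y∈)))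
      ∷ All.tabulate (λ y∈ px≡y → px∉ (subst (_∈ _) (sym px≡y) y∈))
      ∷ endpoints-withMates-! xs! xs<
      where
      x∉ : x ∉ endpoints (withMates xs)
      x∉ x∈ with ∈-endpoints-withMates x∈
      ... | y , y∈xs , inj₁ refl = All.lookup x∉xs y∈xs refl
      ... | y , y∈xs , inj₂ refl = Fin.<-asym (All.lookup xs< y∈xs) (subst (p y <_) (involutive P y) x<px)
      px∉ : p x ∉ endpoints (withMates xs)
      px∉ px∈ with ∈-endpoints-withMates px∈
      ... | y , y∈xs , inj₁ refl = Fin.<-asym x<px (subst (p x <_) (involutive P x) (All.lookup xs< y∈xs))
      ... | y , y∈xs , inj₂ px≡py = All.lookup x∉xs y∈xs (injective P px≡py)

    toList-isMatching : IsMatching G toList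
    toList-isMatching =
      All.map⁺ (All.tabulate λ x∈ → let x<px = ∈-filter-allFin⁻ lower? x∈ in x<px , adjacent P (Fin.<⇒≢ x<px ∘ sym)) ,
      endpoints-withMates-! (filter-allFin-! lower?) (All.tabulate (∈-filter-allFin⁻ lower?))

    size-toList : ∣ P ∣ ≡ 2 * length toList
    size-toList = size-endpoints P toList (proj₂ toList-isMatching) moved⇒∈ ∈⇒moved
      where
      moved⇒∈ : ∀ {x} → p x ≢ x → x ∈ endpoints toList
      moved⇒∈ {x} px≢x with Fin.<-cmp x (p x)
      ... | tri< x<px _ _ = endpoints-left (∈-toList⁺ x<px)
      ... | tri≈ _ x≡px _ = contradiction (sym x≡px) px≢x
      ... | tri> _ _ px<x = endpoints-right
        (subst (λ y → (p x , y) ∈ toList) (involutive P x) (∈-toList⁺ (subst (p x <_) (sym (involutive P x)) px<x)))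
      ∈⇒moved : ∀ {x} → x ∈ endpoints toList → p x ≢ x
      ∈⇒moved x∈ with ∈-endpoints-withMates x∈
      ... | y , y∈ , inj₁ refl = Fin.<⇒≢ (∈-filter-allFin⁻ lower? y∈) ∘ sym
      ... | y , y∈ , inj₂ refl = moved-mate P (Fin.<⇒≢ (∈-filter-allFin⁻ lower? y∈) ∘ sym)

  toList-InB2 : ∀ P Q → EdgeDisjoint P Q → InB2 G (toList P) (toList Q)
  toList-InB2 P Q d = toList-isMatching P , toList-isMatching Q , λ (u , v) e∈P e∈Q →
    let u<pu , v≡pu = ∈-toList⁻ P e∈P
        _ , v≡qu = ∈-toList⁻ Q e∈Q
    in Fin.<⇒≢ u<pu (sym (d u (trans (sym v≡pu) v≡qu)))

  -- From λ₂ and α₂ to optimal pairs, and the conclusion.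

  fromList-optimal : ∀ {l a H H′} → (∀ K K′ → InB2 G K K′ → length K + length K′ ≤ l) →
    (∀ K K′ → InB2 G K K′ → length K + length K′ ≡ l → length K ⊔ length K′ ≤ a) →
    ((isH , isH′ , _) : InB2 G H H′) → length H + length H′ ≡ l → length H ≡ a →
    Optimal (fromList isH) (fromList isH′)
  fromList-optimal {H = H} {H′} l-max a-max b@(isH , isH′ , _) refl refl = record
    { disjoint = fromList-disjoint {H} {H′} b
    ; total-max = λ P Q d → begin
        ∣ P ∣ + ∣ Q ∣                              ≡⟨ sizes P Q ⟩
        2 * (length (toList P) + length (toList Q))  ≤⟨ ℕ.*-monoʳ-≤ 2 (l-max _ _ (toList-InB2 P Q d)) ⟩
        2 * (length H + length H′)                 ≡⟨ total ⟨
        ∣ fromList isH ∣ + ∣ fromList isH′ ∣       ∎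
    ; largest-max = λ P Q d ≤total → begin
        ∣ P ∣                                      ≡⟨ size-toList P ⟩
        2 * length (toList P)                      ≤⟨ ℕ.*-monoʳ-≤ 2 (ℕ.≤-trans (ℕ.m≤m⊔n _ (length (toList Q))) (a-max _ _ (toList-InB2 P Q d)
          -- `a-max` applies only to pairs whose total is exactly `l`, so `≤total` and `l-max` are
          -- combined into an equality.
          (ℕ.≤-antisym (l-max _ _ (toList-InB2 P Q d)) (ℕ.*-cancelˡ-≤ 2 (begin
            2 * (length H + length H′)                   ≡⟨ total ⟨
            ∣ fromList isH ∣ + ∣ fromList isH′ ∣         ≤⟨ ≤total ⟩
            ∣ P ∣ + ∣ Q ∣                                ≡⟨ sizes P Q ⟩
            2 * (length (toList P) + length (toList Q))  ∎))))) ⟩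
        2 * length H                               ≡⟨ size-fromList isH ⟨
        ∣ fromList isH ∣                           ∎
    }
    where
    open ℕ.≤-Reasoning
    total : ∣ fromList isH ∣ + ∣ fromList isH′ ∣ ≡ 2 * (length H + length H′)
    total = trans (cong₂ _+_ (size-fromList isH) (size-fromList isH′)) (sym (ℕ.*-distribˡ-+ 2 (length H) (length H′)))
    sizes : ∀ P Q → ∣ P ∣ + ∣ Q ∣ ≡ 2 * (length (toList P) + length (toList Q))
    sizes P Q = trans (cong₂ _+_ (size-toList P) (size-toList Q)) (sym (ℕ.*-distribˡ-+ 2 (length (toList P)) _))

  InB2-swap : ∀ H H′ → InB2 G H H′ → InB2 G H′ H
  InB2-swap _ _ (isH , isH′ , H∩H′) = isH′ , isH , λ e e∈H′ e∈H → H∩H′ e e∈H e∈H′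

  -- The maximum may be attained by the second member; then the pair is swapped.
  attaining-largest : ∀ {l a} → (∃[ H ] ∃[ H′ ] (InB2 G H H′ × length H + length H′ ≡ l × length H ⊔ length H′ ≡ a)) →
    ∃[ H ] ∃[ H′ ] (InB2 G H H′ × length H + length H′ ≡ l × length H ≡ a)
  attaining-largest (H , H′ , b , sum≡l , max≡a) with ℕ.⊔-sel (length H) (length H′)
  ... | inj₁ e = H , H′ , b , sum≡l , trans (sym e) max≡a
  ... | inj₂ e = H′ , H , InB2-swap H H′ b , trans (ℕ.+-comm (length H′) _) sum≡l , trans (sym e) max≡a

theorem1 : ∀ (n : ℕ) (G : Graph n) → HasEdge G →
    ∀ (ν α : ℕ) → IsNu G ν → IsAlpha2 G α → 4 * ν ≤ 5 * α
theorem1 n G _ _ _ ((M , isM , refl) , _) (l , (_ , l-max) , attained , a-max) with attaining-largest {G = G} attained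
... | H , H′ , b@(isH , _) , sum≡l , refl = ℕ.*-cancelˡ-≤ 2 (begin
  2 * (4 * length M)              ≡⟨ x∙yz≈y∙xz 2 4 (length M) ⟩
  4 * (2 * length M)              ≡⟨ cong (4 *_) (size-fromList {G = G} isM) ⟨
  -- `n` rounds of relinking suffice, as the overlap never exceeds `n`.
  4 * ∣ fromList {G = G} isM ∣    ≤⟨ optimal-bound (fromList isM) n (fromList-optimal {G = G} {H = H} {H′} l-max a-max b sum≡l refl) (ℕ.m≤n+m n _) ⟩
  5 * ∣ fromList {G = G} isH ∣    ≡⟨ cong (5 *_) (size-fromList {G = G} isH) ⟩
  5 * (2 * length H)              ≡⟨ x∙yz≈y∙xz 5 2 (length H) ⟩
  2 * (5 * length H)              ∎)
  where
  open ℕ.≤-Reasoning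
  open import Algebra.Properties.CommutativeSemigroup ℕ.*-commutativeSemigroup using (x∙yz≈y∙xz)
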